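{- Let $M\in\Lambda^{001}_\infty$. The following are equivalent: (1) $M$ is solvable in $\Lambda^{001}_\infty$; (2) $M$ is head-normalisable; (3) $M$ is solvable in $\Lambda$.
   Context: Fix an infinite set $\mathcal V$ of variables. $\Lambda$ is the set of ordinary (finite) λ-terms, and $\Lambda^{001}_\infty=\nu Y.\mu X.(\mathcal V+\lambda\mathcal V.X+(X)Y)$ is the set of possibly infinite syntax trees built from variables, abstractions $\lambda x.M$ and applications $(M)N$, in which every infinite branch passes infinitely often through the argument (right) subterm of an application; terms are up to α-equivalence. $\to_\beta$ is one-step β-reduction, $\to_\beta^*$ its reflexive–transitive closure, and $\to_\beta^\infty$ the 001-strongly convergent closure: $M\to_\beta^\infty x$ if $M\to_\beta^*x$; $M\to_\beta^\infty\lambda x.P'$ if $M\to_\beta^*\lambda x.P$, $P\to_\beta^\infty P'$; $M\to_\beta^\infty(P')Q'$ if $M\to_\beta^*(P)Q$, $P\to_\beta^\infty P'$, $Q\to_\beta^\infty Q'$, with possibly infinite derivations in which every infinite branch passes infinitely often through the premise $Q\to_\beta^\infty Q'$. $M$ is solvable in $\Lambda^{001}_\infty$ (resp. in $\Lambda$) if there exist variables $x_1,\dots,x_m$ and terms $N_1,\dots,N_n\in\Lambda^{001}_\infty$ (resp. $\in\Lambda$) such that $(\dots((\lambda x_1\dots\lambda x_m.M)N_1)\dots)N_n\to_\beta^\infty\lambda x.x$ (resp. $\to_\beta^*\lambda x.x$). A head normal form is a term $\lambda x_1\dots\lambda x_m.(\dots((y)Q_1)\dots)Q_n$; $M$ is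 head-normalisable if $M\to_\beta^\infty N$ for some head normal form $N$ (equivalently, by a result of the paper, the head reduction strategy from $M$ reaches a head normal form). -}

module Defs where

open import Data.Nat using (ℕ; zero; suc; _≟_)
open import Data.List using (List; []; _∷_; _++_; [_])
open import Data.List.Relation.Unary.All using (All)
open import Data.Product using (Σ; ∃; _×_; _,_)
open import Data.Unit using (⊤)
open import Data.Empty using (⊥)
open import Relation.Nullary using (yes; no; ¬_)
open import Relation.Binary.PropositionalEquality using (_≡_; _≗_)
open import Relation.Binary.Construct.Closure.ReflexiveTransitive using (Star)

-- Coinductive types are unavailable (--guardedness is not permitted), so a
-- possibly infinite λ-tree is represented by its labelling function on
-- positions (paths from the root).  Variables use de Bruijn indices, so
-- terms are automatically taken up to α-equivalence; free variable x is
-- the index x at the root (and x + k under k binders).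
-- Two trees are identified when they agree at every position (_≗_).

data Dir : Set where
  body left right : Dir

Pos : Set
Pos = List Dir

data Node : Set where
  var  : ℕ → Node
  lam  : Node
  app  : Node
  none : Node          -- position outside the tree

Tree : Set
Tree = Pos → Node

child : Dir → Tree → Tree
child d t p = t (d ∷ p)

_·_ : Pos → Dir → Pos
p · d = p ++ [ d ]

varT : ℕ → Tree
varT x [] = var x
varT x (_ ∷ _) = none

lamT : Tree → Tree
lamT b [] = lam
lamT b (body ∷ p) = b p
lamT b (left ∷ p) = none
lamT b (right ∷ p) = none

appT : Tree → Tree → Tree
appT f a [] = app
appT f a (body ∷ p) = none
appT f a (left ∷ p) = f p
appT f a (right ∷ p) = a p

-- Well-formedness: membership in Λ^001_∞ = νY.μX.(V + λV.X + (X)Y).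

HasChild : Node → Dir → Set
HasChild lam body = ⊤
HasChild app left = ⊤
HasChild app right = ⊤
HasChild _ _ = ⊥

Present : Node → Set
Present n = ¬ (n ≡ none)

data Acc001 (t : Tree) : Pos → Set where
  accVar : ∀ {p x} → t p ≡ var x → Acc001 t p
  accLam : ∀ {p} → t p ≡ lam → Acc001 t (p · body) → Acc001 t p
  accApp : ∀ {p} → t p ≡ app → Acc001 t (p · left) → Acc001 t p

-- t is a (possibly infinite) syntax tree in which every infinite branch
-- passes infinitely often through the argument of an application
record Λ∞ (t : Tree) : Set where
  field
    root    : Present (t [])
    shape   : ∀ p d → (Present (t (p · d)) → HasChild (t p) d)
                    × (HasChild (t p) d → Present (t (p · d)))
    acc001  : ∀ p → Present (t p) → Acc001 t p

ext : (ℕ → ℕ) → ℕ → ℕ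
ext ρ zero = zero
ext ρ (suc x) = suc (ρ x)

mapNode : (ℕ → ℕ) → Node → Node
mapNode ρ (var x) = var (ρ x)
mapNode ρ lam = lam
mapNode ρ app = app
mapNode ρ none = none

renT : (ℕ → ℕ) → Tree → Tree
renT ρ t [] = mapNode ρ (t [])
renT ρ t (body ∷ p) = renT (ext ρ) (child body t) p
renT ρ t (left ∷ p) = renT ρ (child left t) p
renT ρ t (right ∷ p) = renT ρ (child right t) p

exts : (ℕ → Tree) → ℕ → Tree
exts σ zero = varT zero
exts σ (suc x) = renT suc (σ x)

subT : (ℕ → Tree) → Tree → Tree
subT σ t p with t []
subT σ t p | var x = σ x p
subT σ t [] | lam = lam
subT σ t (body ∷ p) | lam = subT (exts σ) (child body t) p
subT σ t (left ∷ p) | lam = none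
subT σ t (right ∷ p) | lam = none
subT σ t [] | app = app
subT σ t (body ∷ p) | app = none
subT σ t (left ∷ p) | app = subT σ (child left t) p
subT σ t (right ∷ p) | app = subT σ (child right t) p
subT σ t p | none = none

single : Tree → ℕ → Tree
single a zero = a
single a (suc x) = varT x

_⟪_⟫ : Tree → Tree → Tree
b ⟪ a ⟫ = subT (single a) b

infix 4 _→β_ _→β*_ _→β∞_

data _→β_ : Tree → Tree → Set where
  β    : ∀ {t t' b a} → t ≗ appT (lamT b) a → t' ≗ b ⟪ a ⟫ → t →β t'
  lamξ : ∀ {t t' b b'} → t ≗ lamT b → t' ≗ lamT b' → b →β b' → t →β t'
  appL : ∀ {t t' f f' a} → t ≗ appT f a → t' ≗ appT f' a → f →β f' → t →β t'
  appR : ∀ {t t' f a a'} → t ≗ appT f a → t' ≗ appT f a' → a →β a' → t →β t'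

_→β*_ : Tree → Tree → Set
_→β*_ = Star _→β_

-- A (possibly infinite) derivation of M →β^∞ N has exactly the shape of N:
-- at each position p of N there is one rule instance, whose conclusion is
-- src p →β^∞ (subtree of N at p).  The derivation is given by the family
-- src of left-hand sides together with, at each node, the finite reduction
-- required by the rule.  Since N ∈ Λ^001_∞, every infinite branch of the
-- derivation passes infinitely often through the argument premise.

RuleAt : (Pos → Tree) → Pos → Node → Set
RuleAt src p (var x) = Σ Tree λ u → (src p →β* u) × (u ≗ varT x)
RuleAt src p lam     = Σ Tree λ u → (src p →β* u) × (u ≗ lamT (src (p · body)))
RuleAt src p app     = Σ Tree λ u → (src p →β* u) ×
                         (u ≗ appT (src (p · left)) (src (p · right)))
RuleAt src p none    = ⊤

record _→β∞_ (M N : Tree) : Set where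
  field
    src   : Pos → Tree
    root  : src [] ≗ M
    rules : ∀ p → RuleAt src p (N p)

-- Named abstraction λx.M in de Bruijn form: free variable x becomes the
-- bound index 0, every other free variable y becomes suc y.

abs-ren : ℕ → ℕ → ℕ
abs-ren x y with y ≟ x
... | yes _ = zero
... | no  _ = suc y

ƛ[_]_ : ℕ → Tree → Tree
ƛ[ x ] M = lamT (renT (abs-ren x) M)

ƛs : List ℕ → Tree → Tree
ƛs [] M = M
ƛs (x ∷ xs) M = ƛ[ x ] (ƛs xs M)

apps : Tree → List Tree → Tree
apps P [] = P
apps P (N ∷ Ns) = apps (appT P N) Ns

𝐈 : Tree
𝐈 = lamT (varT zero)

data FinTerm : Set where
  var : ℕ → FinTerm
  lam : FinTerm → FinTerm
  app : FinTerm → FinTerm → FinTerm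

⌜_⌝ : FinTerm → Tree
⌜ var x ⌝ = varT x
⌜ lam M ⌝ = lamT ⌜ M ⌝
⌜ app M N ⌝ = appT ⌜ M ⌝ ⌜ N ⌝

⌜_⌝s : List FinTerm → List Tree
⌜ [] ⌝s = []
⌜ N ∷ Ns ⌝s = ⌜ N ⌝ ∷ ⌜ Ns ⌝s

SolvableInΛ∞ : Tree → Set
SolvableInΛ∞ M = Σ (List ℕ) λ xs → Σ (List Tree) λ Ns →
  All Λ∞ Ns × (apps (ƛs xs M) Ns →β∞ 𝐈)

SolvableInΛ : Tree → Set
SolvableInΛ M = Σ (List ℕ) λ xs → Σ (List FinTerm) λ Ns →
  Σ Tree λ u → (apps (ƛs xs M) ⌜ Ns ⌝s →β* u) × (u ≗ 𝐈)

data HeadApp (t : Tree) : Set where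
  var : ∀ y → t ≗ varT y → HeadApp t
  app : ∀ f a → t ≗ appT f a → HeadApp f → HeadApp t

data HNF (t : Tree) : Set where
  head : HeadApp t → HNF t
  lam  : ∀ b → t ≗ lamT b → HNF b → HNF t

HeadNormalisable : Tree → Set
HeadNormalisable M = Σ Tree λ N → Λ∞ N × (M →β∞ N) × HNF N

{-# OPTIONS --safe #-}
module Submission where

-- The proof goes through non-idempotent intersection types.  Typability is
-- preserved by β-expansion, and every typable term of Λ∞ head-normalises by a
-- finite reduction, since each head step strictly decreases the size of the
-- derivation.  If (λx⃗.M)N⃗ →β^∞ λx.x, the head normal form λx.x is already
-- reached by a finite reduction; it is typable, so (λx⃗.M)N⃗ and hence M are
-- typable.  Conversely a head normal form λx₁…λxₘ.(y)Q₁…Q_k is typable with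
-- y : [] ⇛ … ⇛ [] ⇛ [o] ⇛ o (k empty multisets).  Expanding this typing back to
-- M, abstracting y if it is free and feeding the finite terms λz₁…λz_k.λz.z in
-- its place gives a closed term of type [o] ⇛ o, whose head normal form can
-- only be λx.x.

open import Defs
open import Data.Nat using (ℕ; zero; suc; _+_; _≤_; _<_; s≤s; z≤n; _≟_)
open import Data.Nat.Properties using (+-assoc; +-monoˡ-≤; +-mono-≤; ≤-trans; n≤1+n; m≤m+n; +-commutativeSemigroup)
open import Data.Nat.Induction using (<-wellFounded)
open import Induction.WellFounded using (Acc; acc)
open import Algebra.Properties.CommutativeSemigroup +-commutativeSemigroup using (interchange; x∙yz≈y∙xz)
open import Data.List using (List; []; _∷_; _++_; [_]; map)
open import Data.List.Properties using (++-assoc; ++-identityʳ; map-++)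
open import Data.List.Relation.Unary.All using (All; []; _∷_)
open import Data.List.Relation.Binary.Permutation.Propositional
  using (_↭_; ↭-refl; ↭-sym; ↭-trans; ↭-reflexive; prep; swap)
import Data.List.Relation.Binary.Permutation.Propositional as ↭
open import Data.List.Relation.Binary.Permutation.Propositional.Properties
  using (++⁺; ++⁺ˡ; ++⁺ʳ; shifts; ↭-empty-inv; ↭-singleton-inv)
open import Data.Product using (∃; ∃₂; _×_; _,_; -,_; proj₁; proj₂; map₁)
open import Data.Sum using (_⊎_; inj₁; inj₂)
open import Data.Unit using (tt)
open import Data.Empty using (⊥-elim)
open import Relation.Nullary using (¬_; yes; no; contradiction)
open import Relation.Binary.PropositionalEquality
  using (_≡_; refl; sym; trans; cong; cong₂; subst; subst₂; _≗_)
open import Relation.Binary.Construct.Closure.ReflexiveTransitive using (ε; _◅_; _◅◅_)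
open import Function.Base using (_∘_)
open import Function.Bundles using (_⇔_; mk⇔)

≗-sym : ∀ {s t : Tree} → s ≗ t → t ≗ s
≗-sym e p = sym (e p)

≗-trans : ∀ {s t u : Tree} → s ≗ t → t ≗ u → s ≗ u
≗-trans e f p = trans (e p) (f p)

emptyT : Tree
emptyT _ = none

subtree : Tree → Pos → Tree
subtree t p q = t (p ++ q)

lamT-cong : ∀ {b b'} → b ≗ b' → lamT b ≗ lamT b'
lamT-cong e [] = refl
lamT-cong e (body ∷ p) = e p
lamT-cong e (left ∷ p) = refl
lamT-cong e (right ∷ p) = refl

appT-cong : ∀ {f f' a a'} → f ≗ f' → a ≗ a' → appT f a ≗ appT f' a'
appT-cong ef ea [] = refl
appT-cong ef ea (body ∷ p) = refl
appT-cong ef ea (left ∷ p) = ef p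
appT-cong ef ea (right ∷ p) = ea p

data FiniteSpine (s : Tree) : Set where
  spine-var : ∀ {x} → s [] ≡ var x → FiniteSpine s
  spine-lam : s [] ≡ lam → FiniteSpine (child body s) → FiniteSpine s
  spine-app : s [] ≡ app → FiniteSpine (child left s) → FiniteSpine s

FiniteSpine-resp : ∀ {s s'} → s ≗ s' → FiniteSpine s → FiniteSpine s'
FiniteSpine-resp e (spine-var x) = spine-var (trans (sym (e [])) x)
FiniteSpine-resp e (spine-lam x a) = spine-lam (trans (sym (e [])) x) (FiniteSpine-resp (λ q → e (body ∷ q)) a)
FiniteSpine-resp e (spine-app x a) = spine-app (trans (sym (e [])) x) (FiniteSpine-resp (λ q → e (left ∷ q)) a)

record WellFormedRoot (s : Tree) : Set where
  field
    children : ∀ d → (Present (s (d ∷ [])) → HasChild (s []) d)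
                   × (HasChild (s []) d → Present (s (d ∷ [])))
    spine    : Present (s []) → FiniteSpine s
open WellFormedRoot

-- Λ∞ with every condition read relative to the subtree it concerns: closure
-- properties are proved for this form, by recursion on relative positions.
Λ∞ˡ : Tree → Set
Λ∞ˡ t = ∀ p → WellFormedRoot (subtree t p)

WellFormedRoot-resp : ∀ {s s'} → s ≗ s' → WellFormedRoot s → WellFormedRoot s'
WellFormedRoot-resp {s} {s'} e w .children d rewrite sym (e []) | sym (e (d ∷ [])) = w .children d
WellFormedRoot-resp {s} {s'} e w .spine pr = FiniteSpine-resp e (w .spine (subst Present (sym (e [])) pr))

Acc001⇒FiniteSpine : ∀ {t p} → Acc001 t p → FiniteSpine (subtree t p)
Acc001⇒FiniteSpine {t} {p} (accVar e) = spine-var (trans (cong t (++-identityʳ p)) e)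
Acc001⇒FiniteSpine {t} {p} (accLam e a) = spine-lam (trans (cong t (++-identityʳ p)) e)
  (FiniteSpine-resp (λ q → cong t (++-assoc p [ body ] q)) (Acc001⇒FiniteSpine a))
Acc001⇒FiniteSpine {t} {p} (accApp e a) = spine-app (trans (cong t (++-identityʳ p)) e)
  (FiniteSpine-resp (λ q → cong t (++-assoc p [ left ] q)) (Acc001⇒FiniteSpine a))

FiniteSpine⇒Acc001 : ∀ {t s} p → FiniteSpine s → s ≗ subtree t p → Acc001 t p
FiniteSpine⇒Acc001 {t} p (spine-var e) f =
  accVar (trans (sym (cong t (++-identityʳ p))) (trans (sym (f [])) e))
FiniteSpine⇒Acc001 {t} p (spine-lam e a) f =
  accLam (trans (sym (cong t (++-identityʳ p))) (trans (sym (f [])) e))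
    (FiniteSpine⇒Acc001 (p · body) a (λ q → trans (f (body ∷ q)) (sym (cong t (++-assoc p [ body ] q)))))
FiniteSpine⇒Acc001 {t} p (spine-app e a) f =
  accApp (trans (sym (cong t (++-identityʳ p))) (trans (sym (f [])) e))
    (FiniteSpine⇒Acc001 (p · left) a (λ q → trans (f (left ∷ q)) (sym (cong t (++-assoc p [ left ] q)))))

Λ∞⇒Λ∞ˡ : ∀ {t} → Λ∞ t → Λ∞ˡ t
Λ∞⇒Λ∞ˡ {t} L p .children d rewrite ++-identityʳ p = Λ∞.shape L p d
Λ∞⇒Λ∞ˡ {t} L p .spine pr = Acc001⇒FiniteSpine (Λ∞.acc001 L p (subst Present (cong t (++-identityʳ p)) pr))

Λ∞ˡ⇒Λ∞ : ∀ {t} → Present (t []) → Λ∞ˡ t → Λ∞ t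
Λ∞ˡ⇒Λ∞ {t} r w = record
  { root = r
  ; shape = shape
  ; acc001 = λ p pr → FiniteSpine⇒Acc001 p (w p .spine (subst Present (sym (cong t (++-identityʳ p))) pr)) (λ _ → refl)
  }
  where
  shape : ∀ p d → (Present (t (p · d)) → HasChild (t p) d) × (HasChild (t p) d → Present (t (p · d)))
  shape p d with w p .children d
  ... | c rewrite ++-identityʳ p = c

Λ∞-spine : ∀ {t} → Λ∞ t → FiniteSpine t
Λ∞-spine L = Λ∞⇒Λ∞ˡ L [] .spine (Λ∞.root L)

Λ∞-resp : ∀ {t t'} → t ≗ t' → Λ∞ t → Λ∞ t'
Λ∞-resp e L = Λ∞ˡ⇒Λ∞ (subst Present (e []) (Λ∞.root L))
  (λ p → WellFormedRoot-resp (λ q → e (p ++ q)) (Λ∞⇒Λ∞ˡ L p))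

Λ∞-subtree : ∀ {t} p → Λ∞ t → Present (t p) → Λ∞ (subtree t p)
Λ∞-subtree {t} p L pr = Λ∞ˡ⇒Λ∞ (subst Present (cong t (sym (++-identityʳ p))) pr)
  (λ q → WellFormedRoot-resp (λ r → cong t (++-assoc p q r)) (Λ∞⇒Λ∞ˡ L (p ++ q)))

emptyT-wf : WellFormedRoot emptyT
emptyT-wf .children d = (λ h → ⊥-elim (h refl)) , λ ()
emptyT-wf .spine h = ⊥-elim (h refl)

var-wf : ∀ {s x} → s [] ≡ var x → (∀ d → s [ d ] ≡ none) → WellFormedRoot s
var-wf {s} e f .children d rewrite e | f d = (λ h → ⊥-elim (h refl)) , λ ()
var-wf {s} e f .spine _ = spine-var e

lam-wf : ∀ {s} → s [] ≡ lam → Present (s [ body ]) → s [ left ] ≡ none → s [ right ] ≡ none →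
         FiniteSpine s → WellFormedRoot s
lam-wf {s} e pb el er a .children body rewrite e = (λ _ → tt) , λ _ → pb
lam-wf {s} e pb el er a .children left rewrite e | el = (λ h → ⊥-elim (h refl)) , λ ()
lam-wf {s} e pb el er a .children right rewrite e | er = (λ h → ⊥-elim (h refl)) , λ ()
lam-wf e pb el er a .spine _ = a

app-wf : ∀ {s} → s [] ≡ app → s [ body ] ≡ none → Present (s [ left ]) → Present (s [ right ]) →
         FiniteSpine s → WellFormedRoot s
app-wf {s} e eb pl pr a .children body rewrite e | eb = (λ h → ⊥-elim (h refl)) , λ ()
app-wf {s} e eb pl pr a .children left rewrite e = (λ _ → tt) , λ _ → pl
app-wf {s} e eb pl pr a .children right rewrite e = (λ _ → tt) , λ _ → pr
app-wf e eb pl pr a .spine _ = a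

Λ∞-varT : ∀ x → Λ∞ (varT x)
Λ∞-varT x = Λ∞ˡ⇒Λ∞ (λ ()) wf
  where
  wf : Λ∞ˡ (varT x)
  wf [] = var-wf refl (λ _ → refl)
  wf (_ ∷ _) = emptyT-wf

Λ∞-lamT : ∀ {b} → Λ∞ b → Λ∞ (lamT b)
Λ∞-lamT L = Λ∞ˡ⇒Λ∞ (λ ()) wf
  where
  wf : Λ∞ˡ (lamT _)
  wf [] = lam-wf refl (Λ∞.root L) refl refl (spine-lam refl (Λ∞-spine L))
  wf (body ∷ p) = Λ∞⇒Λ∞ˡ L p
  wf (left ∷ p) = emptyT-wf
  wf (right ∷ p) = emptyT-wf

Λ∞-appT : ∀ {f a} → Λ∞ f → Λ∞ a → Λ∞ (appT f a)
Λ∞-appT Lf La = Λ∞ˡ⇒Λ∞ (λ ()) wf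
  where
  wf : Λ∞ˡ (appT _ _)
  wf [] = app-wf refl refl (Λ∞.root Lf) (Λ∞.root La) (spine-app refl (Λ∞-spine Lf))
  wf (body ∷ p) = emptyT-wf
  wf (left ∷ p) = Λ∞⇒Λ∞ˡ Lf p
  wf (right ∷ p) = Λ∞⇒Λ∞ˡ La p

Λ∞-child : ∀ {t} d → Λ∞ t → HasChild (t []) d → Λ∞ (child d t)
Λ∞-child d L h = Λ∞ˡ⇒Λ∞ (proj₂ (Λ∞.shape L [] d) h) (λ p → Λ∞⇒Λ∞ˡ L (d ∷ p))

Λ∞-body : ∀ {t b} → Λ∞ t → t ≗ lamT b → Λ∞ b
Λ∞-body L e = Λ∞-child body (Λ∞-resp e L) tt

Λ∞-fun : ∀ {t f a} → Λ∞ t → t ≗ appT f a → Λ∞ f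
Λ∞-fun L e = Λ∞-child left (Λ∞-resp e L) tt

Λ∞-arg : ∀ {t f a} → Λ∞ t → t ≗ appT f a → Λ∞ a
Λ∞-arg L e = Λ∞-child right (Λ∞-resp e L) tt

-- Closure of Λ∞ under substitution and β

mapNode-present : ∀ ρ {n} → Present n → Present (mapNode ρ n)
mapNode-present ρ {var x} h = λ ()
mapNode-present ρ {lam} h = λ ()
mapNode-present ρ {app} h = λ ()
mapNode-present ρ {none} h = h

mapNode-present⁻ : ∀ ρ {n} → Present (mapNode ρ n) → Present n
mapNode-present⁻ ρ {var x} h = λ ()
mapNode-present⁻ ρ {lam} h = λ ()
mapNode-present⁻ ρ {app} h = λ ()
mapNode-present⁻ ρ {none} h = h

HasChild-mapNode : ∀ ρ n d → HasChild (mapNode ρ n) d ≡ HasChild n d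
HasChild-mapNode ρ (var x) d = refl
HasChild-mapNode ρ lam d = refl
HasChild-mapNode ρ app d = refl
HasChild-mapNode ρ none d = refl

renT-child : ∀ ρ s d → ∃ λ ρ' → renT ρ s [ d ] ≡ mapNode ρ' (s [ d ])
renT-child ρ s body = ext ρ , refl
renT-child ρ s left = ρ , refl
renT-child ρ s right = ρ , refl

renT-spine : ∀ ρ {s} → FiniteSpine s → FiniteSpine (renT ρ s)
renT-spine ρ (spine-var e) = spine-var (cong (mapNode ρ) e)
renT-spine ρ (spine-lam e a) = spine-lam (cong (mapNode ρ) e) (renT-spine (ext ρ) a)
renT-spine ρ (spine-app e a) = spine-app (cong (mapNode ρ) e) (renT-spine ρ a)

renT-wf : ∀ ρ {s} → WellFormedRoot s → WellFormedRoot (renT ρ s)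
renT-wf ρ {s} w .children d with renT-child ρ s d
... | ρ' , e rewrite e | HasChild-mapNode ρ (s []) d =
  (λ h → w .children d .proj₁ (mapNode-present⁻ ρ' h)) , (λ h → mapNode-present ρ' (w .children d .proj₂ h))
renT-wf ρ {s} w .spine h = renT-spine ρ (w .spine (mapNode-present⁻ ρ h))

subtree-renT : ∀ p ρ t → ∃ λ ρ' → subtree (renT ρ t) p ≗ renT ρ' (subtree t p)
subtree-renT [] ρ t = ρ , λ q → refl
subtree-renT (body ∷ p) ρ t = subtree-renT p (ext ρ) (child body t)
subtree-renT (left ∷ p) ρ t = subtree-renT p ρ (child left t)
subtree-renT (right ∷ p) ρ t = subtree-renT p ρ (child right t)

Λ∞-renT : ∀ ρ {t} → Λ∞ t → Λ∞ (renT ρ t)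
Λ∞-renT ρ {t} L = Λ∞ˡ⇒Λ∞ (mapNode-present ρ (Λ∞.root L)) wf
  where
  wf : Λ∞ˡ (renT ρ t)
  wf p with subtree-renT p ρ t
  ... | ρ' , e = WellFormedRoot-resp (≗-sym e) (renT-wf ρ' (Λ∞⇒Λ∞ˡ L p))

subT-var : ∀ σ t {x} → t [] ≡ var x → subT σ t ≗ σ x
subT-var σ t e p rewrite e = refl

subT-lam : ∀ σ t → t [] ≡ lam → subT σ t ≗ lamT (subT (exts σ) (child body t))
subT-lam σ t e [] rewrite e = refl
subT-lam σ t e (body ∷ p) rewrite e = refl
subT-lam σ t e (left ∷ p) rewrite e = refl
subT-lam σ t e (right ∷ p) rewrite e = refl

subT-app : ∀ σ t → t [] ≡ app → subT σ t ≗ appT (subT σ (child left t)) (subT σ (child right t))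
subT-app σ t e [] rewrite e = refl
subT-app σ t e (body ∷ p) rewrite e = refl
subT-app σ t e (left ∷ p) rewrite e = refl
subT-app σ t e (right ∷ p) rewrite e = refl

subT-none : ∀ σ t → t [] ≡ none → subT σ t ≗ emptyT
subT-none σ t e p rewrite e = refl

AllΛ∞ : (ℕ → Tree) → Set
AllΛ∞ σ = ∀ x → Λ∞ (σ x)

exts-Λ∞ : ∀ {σ} → AllΛ∞ σ → AllΛ∞ (exts σ)
exts-Λ∞ h zero = Λ∞-varT zero
exts-Λ∞ h (suc x) = Λ∞-renT suc (h x)

single-Λ∞ : ∀ {a} → Λ∞ a → AllΛ∞ (single a)
single-Λ∞ La zero = La
single-Λ∞ La (suc x) = Λ∞-varT x

subT-spine : ∀ σ {t} → FiniteSpine t → AllΛ∞ σ → FiniteSpine (subT σ t)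
subT-spine σ {t} (spine-var e) h = FiniteSpine-resp (≗-sym (subT-var σ t e)) (Λ∞-spine (h _))
subT-spine σ {t} (spine-lam e a) h =
  FiniteSpine-resp (≗-sym (subT-lam σ t e)) (spine-lam refl (subT-spine (exts σ) a (exts-Λ∞ h)))
subT-spine σ {t} (spine-app e a) h =
  FiniteSpine-resp (≗-sym (subT-app σ t e)) (spine-app refl (subT-spine σ a h))

spine-present : ∀ {s} → FiniteSpine s → Present (s [])
spine-present (spine-var e) e' with trans (sym e) e'
... | ()
spine-present (spine-lam e _) e' with trans (sym e) e'
... | ()
spine-present (spine-app e _) e' with trans (sym e) e'
... | ()

subT-wf : ∀ p σ t → Λ∞ˡ t → AllΛ∞ σ → WellFormedRoot (subtree (subT σ t) p)
subT-wf-at : ∀ p σ t → Λ∞ˡ t → AllΛ∞ σ → ∀ n → t [] ≡ n → WellFormedRoot (subtree (subT σ t) p)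
subT-wf p σ t w h = subT-wf-at p σ t w h (t []) refl
subT-wf-at p σ t w h (var x) e = WellFormedRoot-resp (λ q → sym (subT-var σ t e (p ++ q))) (Λ∞⇒Λ∞ˡ (h x) p)
subT-wf-at p σ t w h none e = WellFormedRoot-resp (λ q → sym (subT-none σ t e (p ++ q))) emptyT-wf
subT-wf-at [] σ t w h lam e = WellFormedRoot-resp (≗-sym (subT-lam σ t e))
  (lam-wf refl (spine-present (subT-spine (exts σ) (w [ body ] .spine body-present) (exts-Λ∞ h))) refl refl
    (spine-lam refl (subT-spine (exts σ) (w [ body ] .spine body-present) (exts-Λ∞ h))))
  where
  body-present : Present (t [ body ])
  body-present = w [] .children body .proj₂ (subst (λ n → HasChild n body) (sym e) tt)
subT-wf-at (body ∷ p) σ t w h lam e = WellFormedRoot-resp (λ q → sym (subT-lam σ t e (body ∷ p ++ q)))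
  (subT-wf p (exts σ) (child body t) (λ p' → w (body ∷ p')) (exts-Λ∞ h))
subT-wf-at (left ∷ p) σ t w h lam e = WellFormedRoot-resp (λ q → sym (subT-lam σ t e (left ∷ p ++ q))) emptyT-wf
subT-wf-at (right ∷ p) σ t w h lam e = WellFormedRoot-resp (λ q → sym (subT-lam σ t e (right ∷ p ++ q))) emptyT-wf
subT-wf-at [] σ t w h app e = WellFormedRoot-resp (≗-sym (subT-app σ t e))
  (app-wf refl refl (spine-present (subT-spine σ (w [ left ] .spine (child-present left)) h))
    (spine-present (subT-spine σ (w [ right ] .spine (child-present right)) h))
    (spine-app refl (subT-spine σ (w [ left ] .spine (child-present left)) h)))
  where
  child-present : ∀ d → {HasChild app d} → Present (t [ d ])
  child-present d {has} = w [] .children d .proj₂ (subst (λ n → HasChild n d) (sym e) has)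
subT-wf-at (body ∷ p) σ t w h app e = WellFormedRoot-resp (λ q → sym (subT-app σ t e (body ∷ p ++ q))) emptyT-wf
subT-wf-at (left ∷ p) σ t w h app e = WellFormedRoot-resp (λ q → sym (subT-app σ t e (left ∷ p ++ q)))
  (subT-wf p σ (child left t) (λ p' → w (left ∷ p')) h)
subT-wf-at (right ∷ p) σ t w h app e = WellFormedRoot-resp (λ q → sym (subT-app σ t e (right ∷ p ++ q)))
  (subT-wf p σ (child right t) (λ p' → w (right ∷ p')) h)

Λ∞-subT : ∀ σ {t} → Λ∞ t → AllΛ∞ σ → Λ∞ (subT σ t)
Λ∞-subT σ {t} L h = Λ∞ˡ⇒Λ∞ (spine-present (subT-spine σ (Λ∞-spine L) h)) (λ p → subT-wf p σ t (Λ∞⇒Λ∞ˡ L) h)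

Λ∞-→β : ∀ {t t'} → Λ∞ t → t →β t' → Λ∞ t'
Λ∞-→β L (β e e') = Λ∞-resp (≗-sym e') (Λ∞-subT _ (Λ∞-body (Λ∞-fun L e) (λ _ → refl)) (single-Λ∞ (Λ∞-arg L e)))
Λ∞-→β L (lamξ e e' r) = Λ∞-resp (≗-sym e') (Λ∞-lamT (Λ∞-→β (Λ∞-body L e) r))
Λ∞-→β L (appL e e' r) = Λ∞-resp (≗-sym e') (Λ∞-appT (Λ∞-→β (Λ∞-fun L e) r) (Λ∞-arg L e))
Λ∞-→β L (appR e e' r) = Λ∞-resp (≗-sym e') (Λ∞-appT (Λ∞-fun L e) (Λ∞-→β (Λ∞-arg L e) r))

Λ∞-⌜_⌝ : ∀ N → Λ∞ ⌜ N ⌝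
Λ∞-⌜ var x ⌝ = Λ∞-varT x
Λ∞-⌜ lam N ⌝ = Λ∞-lamT Λ∞-⌜ N ⌝
Λ∞-⌜ app N N' ⌝ = Λ∞-appT Λ∞-⌜ N ⌝ Λ∞-⌜ N' ⌝

Λ∞-⌜_⌝s : ∀ Ns → All Λ∞ ⌜ Ns ⌝s
Λ∞-⌜ [] ⌝s = []
Λ∞-⌜ N ∷ Ns ⌝s = Λ∞-⌜ N ⌝ ∷ Λ∞-⌜ Ns ⌝s

Λ∞-apps : ∀ {t} Ns → Λ∞ t → All Λ∞ Ns → Λ∞ (apps t Ns)
Λ∞-apps [] L [] = L
Λ∞-apps (N ∷ Ns) L (LN ∷ LNs) = Λ∞-apps Ns (Λ∞-appT L LN) LNs

Λ∞-ƛs : ∀ xs {M} → Λ∞ M → Λ∞ (ƛs xs M)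
Λ∞-ƛs [] L = L
Λ∞-ƛs (x ∷ xs) L = Λ∞-lamT (Λ∞-renT _ (Λ∞-ƛs xs L))

¬Present⇒none : ∀ {n : Node} → ¬ Present n → n ≡ none
¬Present⇒none {var x} h = contradiction (λ ()) h
¬Present⇒none {lam} h = contradiction (λ ()) h
¬Present⇒none {app} h = contradiction (λ ()) h
¬Present⇒none {none} h = refl

Λ∞-none-below : ∀ {t} → Λ∞ t → ∀ p q → t p ≡ none → t (p ++ q) ≡ none
Λ∞-none-below {t} L p [] e = trans (cong t (++-identityʳ p)) e
Λ∞-none-below {t} L p (d ∷ q) e =
  trans (cong t (sym (++-assoc p [ d ] q)))
    (Λ∞-none-below L (p · d) q (¬Present⇒none (λ pr → subst (λ n → HasChild n d) e (proj₁ (Λ∞.shape L p d) pr))))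

Λ∞-no-child : ∀ {t} → Λ∞ t → ∀ {n} d q → t [] ≡ n → ¬ HasChild n d → t (d ∷ q) ≡ none
Λ∞-no-child {t} L d q e h =
  Λ∞-none-below L [ d ] q (¬Present⇒none (λ pr → h (subst (λ n → HasChild n d) e (proj₁ (Λ∞.shape L [] d) pr))))

Λ∞-var-view : ∀ {t x} → Λ∞ t → t [] ≡ var x → t ≗ varT x
Λ∞-var-view L e [] = e
Λ∞-var-view L e (d ∷ q) = Λ∞-no-child L d q e λ ()

Λ∞-lam-view : ∀ {t} → Λ∞ t → t [] ≡ lam → t ≗ lamT (child body t)
Λ∞-lam-view L e [] = e
Λ∞-lam-view L e (body ∷ q) = refl
Λ∞-lam-view L e (left ∷ q) = Λ∞-no-child L left q e λ ()
Λ∞-lam-view L e (right ∷ q) = Λ∞-no-child L right q e λ ()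

Λ∞-app-view : ∀ {t} → Λ∞ t → t [] ≡ app → t ≗ appT (child left t) (child right t)
Λ∞-app-view L e [] = e
Λ∞-app-view L e (body ∷ q) = Λ∞-no-child L body q e λ ()
Λ∞-app-view L e (left ∷ q) = refl
Λ∞-app-view L e (right ∷ q) = refl

-- Non-idempotent intersection types

-- A multiset of types is a list read up to _↭_; a context is a multiset of
-- declarations, in which a variable may be declared several times.
data Ty : Set where
  o   : Ty
  _⇛_ : List Ty → Ty → Ty
infixr 5 _⇛_

Ctx : Set
Ctx = List (ℕ × Ty)

types₀ : Ctx → List Ty
types₀ [] = []
types₀ ((zero , B) ∷ Γ) = B ∷ types₀ Γ
types₀ ((suc x , B) ∷ Γ) = types₀ Γ

lower : Ctx → Ctx
lower [] = []
lower ((zero , B) ∷ Γ) = lower Γ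
lower ((suc x , B) ∷ Γ) = (x , B) ∷ lower Γ

renCtx : (ℕ → ℕ) → Ctx → Ctx
renCtx ρ = map (map₁ ρ)

types₀-++ : ∀ Γ Δ → types₀ (Γ ++ Δ) ≡ types₀ Γ ++ types₀ Δ
types₀-++ [] Δ = refl
types₀-++ ((zero , B) ∷ Γ) Δ = cong (B ∷_) (types₀-++ Γ Δ)
types₀-++ ((suc x , B) ∷ Γ) Δ = types₀-++ Γ Δ

lower-++ : ∀ Γ Δ → lower (Γ ++ Δ) ≡ lower Γ ++ lower Δ
lower-++ [] Δ = refl
lower-++ ((zero , B) ∷ Γ) Δ = lower-++ Γ Δ
lower-++ ((suc x , B) ∷ Γ) Δ = cong ((x , B) ∷_) (lower-++ Γ Δ)

types₀-ext : ∀ ρ Γ → types₀ (renCtx (ext ρ) Γ) ≡ types₀ Γ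
types₀-ext ρ [] = refl
types₀-ext ρ ((zero , B) ∷ Γ) = cong (B ∷_) (types₀-ext ρ Γ)
types₀-ext ρ ((suc x , B) ∷ Γ) = types₀-ext ρ Γ

lower-ext : ∀ ρ Γ → lower (renCtx (ext ρ) Γ) ≡ renCtx ρ (lower Γ)
lower-ext ρ [] = refl
lower-ext ρ ((zero , B) ∷ Γ) = lower-ext ρ Γ
lower-ext ρ ((suc x , B) ∷ Γ) = cong ((ρ x , B) ∷_) (lower-ext ρ Γ)

types₀-suc : ∀ Γ → types₀ (renCtx suc Γ) ≡ []
types₀-suc [] = refl
types₀-suc (_ ∷ Γ) = types₀-suc Γ

lower-suc : ∀ Γ → lower (renCtx suc Γ) ≡ Γ
lower-suc [] = refl
lower-suc ((x , B) ∷ Γ) = cong ((x , B) ∷_) (lower-suc Γ)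

types₀-↭ : ∀ {Γ Δ} → Γ ↭ Δ → types₀ Γ ↭ types₀ Δ
types₀-↭ ↭.refl = ↭-refl
types₀-↭ (prep (zero , B) p) = prep B (types₀-↭ p)
types₀-↭ (prep (suc x , B) p) = types₀-↭ p
types₀-↭ (swap (zero , B) (zero , C) p) = swap B C (types₀-↭ p)
types₀-↭ (swap (zero , B) (suc y , C) p) = prep B (types₀-↭ p)
types₀-↭ (swap (suc x , B) (zero , C) p) = prep C (types₀-↭ p)
types₀-↭ (swap (suc x , B) (suc y , C) p) = types₀-↭ p
types₀-↭ (↭.trans p q) = ↭-trans (types₀-↭ p) (types₀-↭ q)

lower-↭ : ∀ {Γ Δ} → Γ ↭ Δ → lower Γ ↭ lower Δ
lower-↭ ↭.refl = ↭-refl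
lower-↭ (prep (zero , B) p) = lower-↭ p
lower-↭ (prep (suc x , B) p) = prep (x , B) (lower-↭ p)
lower-↭ (swap (zero , B) (zero , C) p) = lower-↭ p
lower-↭ (swap (zero , B) (suc y , C) p) = prep (y , C) (lower-↭ p)
lower-↭ (swap (suc x , B) (zero , C) p) = prep (x , B) (lower-↭ p)
lower-↭ (swap (suc x , B) (suc y , C) p) = swap (x , B) (y , C) (lower-↭ p)
lower-↭ (↭.trans p q) = ↭-trans (lower-↭ p) (lower-↭ q)

-- The index n of Typed is the size of the derivation: the number of its λ-
-- and application rules.
data Typed : Tree → Ty → Ctx → ℕ → Set
data TypedAll : Tree → List Ty → Ctx → ℕ → Set

data Typed where
  ⊢var : ∀ {t x A} → t [] ≡ var x → Typed t A [ (x , A) ] 0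
  ⊢lam : ∀ {t A As Γ n} → t [] ≡ lam → Typed (child body t) A Γ n → As ↭ types₀ Γ →
         Typed t (As ⇛ A) (lower Γ) (suc n)
  ⊢app : ∀ {t As A Γ Δ n m} → t [] ≡ app → Typed (child left t) (As ⇛ A) Γ n →
         TypedAll (child right t) As Δ m → Typed t A (Γ ++ Δ) (suc (n + m))

data TypedAll where
  ⊢[] : ∀ {a} → TypedAll a [] [] 0
  ⊢∷  : ∀ {a B Bs Γ Δ n m} → Typed a B Γ n → TypedAll a Bs Δ m → TypedAll a (B ∷ Bs) (Γ ++ Δ) (n + m)

Typed-resp : ∀ {s s' A Γ n} → s ≗ s' → Typed s A Γ n → Typed s' A Γ n
TypedAll-resp : ∀ {s s' As Γ n} → s ≗ s' → TypedAll s As Γ n → TypedAll s' As Γ n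
Typed-resp e (⊢var x) = ⊢var (trans (sym (e [])) x)
Typed-resp e (⊢lam x d p) = ⊢lam (trans (sym (e [])) x) (Typed-resp (λ q → e (body ∷ q)) d) p
Typed-resp e (⊢app x d ds) =
  ⊢app (trans (sym (e [])) x) (Typed-resp (λ q → e (left ∷ q)) d) (TypedAll-resp (λ q → e (right ∷ q)) ds)
TypedAll-resp e ⊢[] = ⊢[]
TypedAll-resp e (⊢∷ d ds) = ⊢∷ (Typed-resp e d) (TypedAll-resp e ds)

data LamTyping (t : Tree) : Ty → Ctx → ℕ → Set where
  lamTyping : ∀ {A As Γ n} → Typed (child body t) A Γ n → As ↭ types₀ Γ →
              LamTyping t (As ⇛ A) (lower Γ) (suc n)

data AppTyping (t : Tree) : Ty → Ctx → ℕ → Set where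
  appTyping : ∀ {As A Γ Δ n m} → Typed (child left t) (As ⇛ A) Γ n → TypedAll (child right t) As Δ m →
              AppTyping t A (Γ ++ Δ) (suc (n + m))

typed-var⁻ : ∀ {t x A Γ n} → Typed t A Γ n → t [] ≡ var x → Γ ≡ [ (x , A) ]
typed-var⁻ (⊢var e₀) e with trans (sym e₀) e
... | refl = refl
typed-var⁻ (⊢lam e₀ _ _) e = contradiction (trans (sym e₀) e) λ ()
typed-var⁻ (⊢app e₀ _ _) e = contradiction (trans (sym e₀) e) λ ()

typed-lam⁻ : ∀ {t A Γ n} → Typed t A Γ n → t [] ≡ lam → LamTyping t A Γ n
typed-lam⁻ (⊢var e₀) e = contradiction (trans (sym e₀) e) λ ()
typed-lam⁻ (⊢lam _ d p) e = lamTyping d p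
typed-lam⁻ (⊢app e₀ _ _) e = contradiction (trans (sym e₀) e) λ ()

typed-app⁻ : ∀ {t A Γ n} → Typed t A Γ n → t [] ≡ app → AppTyping t A Γ n
typed-app⁻ (⊢var e₀) e = contradiction (trans (sym e₀) e) λ ()
typed-app⁻ (⊢lam e₀ _ _) e = contradiction (trans (sym e₀) e) λ ()
typed-app⁻ (⊢app _ d ds) e = appTyping d ds

typed-present : ∀ {t A Γ n} → Typed t A Γ n → Present (t [])
typed-present (⊢var e₀) e = contradiction (trans (sym e₀) e) λ ()
typed-present (⊢lam e₀ _ _) e = contradiction (trans (sym e₀) e) λ ()
typed-present (⊢app e₀ _ _) e = contradiction (trans (sym e₀) e) λ ()

renCtx-++ : ∀ ρ Γ Δ → renCtx ρ (Γ ++ Δ) ≡ renCtx ρ Γ ++ renCtx ρ Δ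
renCtx-++ ρ = map-++ (map₁ ρ)

typed-renT : ∀ ρ {s A Γ n} → Typed s A Γ n → Typed (renT ρ s) A (renCtx ρ Γ) n
typedAll-renT : ∀ ρ {s As Γ n} → TypedAll s As Γ n → TypedAll (renT ρ s) As (renCtx ρ Γ) n
typed-renT ρ (⊢var e) = ⊢var (cong (mapNode ρ) e)
typed-renT ρ (⊢lam {Γ = Γ} e d p) =
  subst (λ Δ → Typed _ _ Δ _) (lower-ext ρ Γ)
    (⊢lam (cong (mapNode ρ) e) (typed-renT (ext ρ) d) (subst (_ ↭_) (sym (types₀-ext ρ Γ)) p))
typed-renT ρ (⊢app {Γ = Γ} {Δ = Δ} e d ds) =
  subst (λ Θ → Typed _ _ Θ _) (sym (renCtx-++ ρ Γ Δ)) (⊢app (cong (mapNode ρ) e) (typed-renT ρ d) (typedAll-renT ρ ds))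
typedAll-renT ρ ⊢[] = ⊢[]
typedAll-renT ρ (⊢∷ {Γ = Γ} {Δ = Δ} d ds) =
  subst (λ Θ → TypedAll _ _ Θ _) (sym (renCtx-++ ρ Γ Δ)) (⊢∷ (typed-renT ρ d) (typedAll-renT ρ ds))

mapNode-var⁻ : ∀ ρ n {y} → mapNode ρ n ≡ var y → ∃ λ x → n ≡ var x × ρ x ≡ y
mapNode-var⁻ ρ (var x) refl = x , refl , refl

mapNode-lam⁻ : ∀ ρ n → mapNode ρ n ≡ lam → n ≡ lam
mapNode-lam⁻ ρ lam refl = refl

mapNode-app⁻ : ∀ ρ n → mapNode ρ n ≡ app → n ≡ app
mapNode-app⁻ ρ app refl = refl

typed-renT⁻ : ∀ ρ s {A Γ n} → Typed (renT ρ s) A Γ n → ∃ λ Γ' → Γ ≡ renCtx ρ Γ' × Typed s A Γ' n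
typedAll-renT⁻ : ∀ ρ s {As Γ n} → TypedAll (renT ρ s) As Γ n → ∃ λ Γ' → Γ ≡ renCtx ρ Γ' × TypedAll s As Γ' n
typed-renT⁻ ρ s {A} (⊢var e) with mapNode-var⁻ ρ (s []) e
... | x , e' , refl = [ (x , A) ] , refl , ⊢var e'
typed-renT⁻ ρ s (⊢lam {As = As} e d p) with typed-renT⁻ (ext ρ) (child body s) d
... | Γ , refl , d' = lower Γ , lower-ext ρ Γ , ⊢lam (mapNode-lam⁻ ρ (s []) e) d' (subst (As ↭_) (types₀-ext ρ Γ) p)
typed-renT⁻ ρ s (⊢app e d ds) with typed-renT⁻ ρ (child left s) d | typedAll-renT⁻ ρ (child right s) ds
... | Γ , refl , d' | Δ , refl , ds' = Γ ++ Δ , sym (renCtx-++ ρ Γ Δ) , ⊢app (mapNode-app⁻ ρ (s []) e) d' ds'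
typedAll-renT⁻ ρ s ⊢[] = [] , refl , ⊢[]
typedAll-renT⁻ ρ s (⊢∷ d ds) with typed-renT⁻ ρ s d | typedAll-renT⁻ ρ s ds
... | Γ , refl , d' | Δ , refl , ds' = Γ ++ Δ , sym (renCtx-++ ρ Γ Δ) , ⊢∷ d' ds'

data TypedSubst (σ : ℕ → Tree) : Ctx → Ctx → ℕ → Set where
  ⊢σ[] : TypedSubst σ [] [] 0
  ⊢σ∷  : ∀ {x B Γ Δ Θ n m} → Typed (σ x) B Γ n → TypedSubst σ Δ Θ m →
         TypedSubst σ ((x , B) ∷ Δ) (Γ ++ Θ) (n + m)

TypedSubst-++ : ∀ {σ Δ Δ' Γ Γ' m m'} → TypedSubst σ Δ Γ m → TypedSubst σ Δ' Γ' m' →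
                TypedSubst σ (Δ ++ Δ') (Γ ++ Γ') (m + m')
TypedSubst-++ ⊢σ[] s' = s'
TypedSubst-++ {Γ' = Γ'} {m' = m'} (⊢σ∷ {Γ = Γ} {Θ = Θ} {n = n} {m = m} d s) s' =
  subst₂ (TypedSubst _ _) (sym (++-assoc Γ Θ Γ')) (sym (+-assoc n m m')) (⊢σ∷ d (TypedSubst-++ s s'))

TypedSubst-split : ∀ {σ} Δ {Δ' Γ m} → TypedSubst σ (Δ ++ Δ') Γ m →
  ∃₂ λ Γ₁ Γ₂ → ∃₂ λ m₁ m₂ → Γ ≡ Γ₁ ++ Γ₂ × m ≡ m₁ + m₂ × TypedSubst σ Δ Γ₁ m₁ × TypedSubst σ Δ' Γ₂ m₂
TypedSubst-split [] s = -, -, -, -, refl , refl , ⊢σ[] , s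
TypedSubst-split (_ ∷ Δ) (⊢σ∷ {Γ = Γ} {n = n} d s) with TypedSubst-split Δ s
... | Γ₁ , Γ₂ , m₁ , m₂ , refl , refl , s₁ , s₂ =
  -, -, -, -, sym (++-assoc Γ Γ₁ Γ₂) , sym (+-assoc n m₁ m₂) , ⊢σ∷ d s₁ , s₂

TypedSubst-exts⁻ : ∀ {σ Δ Γ m} → TypedSubst (exts σ) Δ Γ m →
  ∃₂ λ Γ' m' → TypedSubst σ (lower Δ) Γ' m' × types₀ Γ ≡ types₀ Δ × lower Γ ≡ Γ'
TypedSubst-exts⁻ ⊢σ[] = -, -, ⊢σ[] , refl , refl
TypedSubst-exts⁻ (⊢σ∷ {x = zero} {B = B} (⊢var refl) s) with TypedSubst-exts⁻ s
... | Γ' , m' , s' , e₀ , e = Γ' , m' , s' , cong (B ∷_) e₀ , e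
TypedSubst-exts⁻ {σ} (⊢σ∷ {x = suc x} {Θ = Θ} d s) with typed-renT⁻ suc (σ x) d | TypedSubst-exts⁻ s
... | Γ , refl , d' | Γ' , m' , s' , e₀ , e =
  Γ ++ Γ' , _ , ⊢σ∷ d' s' ,
  trans (types₀-++ (renCtx suc Γ) Θ) (trans (cong (_++ types₀ Θ) (types₀-suc Γ)) e₀) ,
  trans (lower-++ (renCtx suc Γ) Θ) (cong₂ _++_ (lower-suc Γ) e)

TypedSubst-exts : ∀ {σ} Δ {Γ m} → TypedSubst σ (lower Δ) Γ m →
  ∃ λ Γ* → TypedSubst (exts σ) Δ Γ* m × types₀ Γ* ≡ types₀ Δ × lower Γ* ≡ Γ
TypedSubst-exts [] ⊢σ[] = [] , ⊢σ[] , refl , refl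
TypedSubst-exts ((zero , B) ∷ Δ) s with TypedSubst-exts Δ s
... | Γ* , s* , e₀ , e = (zero , B) ∷ Γ* , ⊢σ∷ (⊢var refl) s* , cong (B ∷_) e₀ , e
TypedSubst-exts ((suc x , B) ∷ Δ) (⊢σ∷ {Γ = Γ} d s) with TypedSubst-exts Δ s
... | Γ* , s* , e₀ , e = renCtx suc Γ ++ Γ* , ⊢σ∷ (typed-renT suc d) s* ,
  trans (types₀-++ (renCtx suc Γ) Γ*) (trans (cong (_++ types₀ Γ*) (types₀-suc Γ)) e₀) ,
  trans (lower-++ (renCtx suc Γ) Γ*) (cong₂ _++_ (lower-suc Γ) e)

TypedSubst-single⁻ : ∀ {a Δ Γ m} → TypedSubst (single a) Δ Γ m →
  ∃₂ λ Θ k → TypedAll a (types₀ Δ) Θ k × Γ ↭ lower Δ ++ Θ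
TypedSubst-single⁻ ⊢σ[] = [] , 0 , ⊢[] , ↭-refl
TypedSubst-single⁻ (⊢σ∷ {x = zero} {Γ = Γ} {Δ = Δ} d s) with TypedSubst-single⁻ s
... | Θ , k , ds , q = Γ ++ Θ , _ , ⊢∷ d ds , ↭-trans (++⁺ˡ Γ q) (shifts Γ (lower Δ))
TypedSubst-single⁻ (⊢σ∷ {x = suc x} d s) with typed-var⁻ d refl | TypedSubst-single⁻ s
... | refl | Θ , k , ds , q = Θ , k , ds , prep _ q

TypedSubst-single : ∀ {a} Δ {Θ m} → TypedAll a (types₀ Δ) Θ m →
  ∃ λ Γ → TypedSubst (single a) Δ Γ m × Γ ↭ lower Δ ++ Θ
TypedSubst-single [] ⊢[] = [] , ⊢σ[] , ↭-refl
TypedSubst-single ((zero , B) ∷ Δ) (⊢∷ {Γ = Γ} d ds) with TypedSubst-single Δ ds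
... | Γ' , s , q = Γ ++ Γ' , ⊢σ∷ d s , ↭-trans (++⁺ˡ Γ q) (shifts Γ (lower Δ))
TypedSubst-single ((suc x , B) ∷ Δ) ds with TypedSubst-single Δ ds
... | Γ' , s , q = (x , B) ∷ Γ' , ⊢σ∷ (⊢var refl) s , prep (x , B) q

-- Subject expansion

TypedThrough : (ℕ → Tree) → Tree → Ty → Ctx → Set
TypedThrough σ t A Γ = ∃₂ λ Δ Γ' → ∃₂ λ k m → Typed t A Δ k × TypedSubst σ Δ Γ' m × Γ' ↭ Γ

TypedAllThrough : (ℕ → Tree) → Tree → List Ty → Ctx → Set
TypedAllThrough σ t As Γ = ∃₂ λ Δ Γ' → ∃₂ λ k m → TypedAll t As Δ k × TypedSubst σ Δ Γ' m × Γ' ↭ Γ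

typed-subT⁻ : ∀ σ t {s A Γ n} → Typed s A Γ n → s ≗ subT σ t → TypedThrough σ t A Γ
typed-subT⁻-at : ∀ σ t {s A Γ n} → Typed s A Γ n → s ≗ subT σ t → ∀ nd → t [] ≡ nd → TypedThrough σ t A Γ
typedAll-subT⁻ : ∀ σ t {s As Γ n} → TypedAll s As Γ n → s ≗ subT σ t → TypedAllThrough σ t As Γ
typed-subT⁻ σ t d e = typed-subT⁻-at σ t d e (t []) refl
typed-subT⁻-at σ t {A = A} {Γ} d e (var x) et =
  -, -, -, -, ⊢var et , ⊢σ∷ (Typed-resp (≗-trans e (subT-var σ t et)) d) ⊢σ[] , ↭-reflexive (++-identityʳ Γ)
typed-subT⁻-at σ t (⊢lam _ db p) e lam et
  with typed-subT⁻ (exts σ) (child body t) db (λ q → trans (e (body ∷ q)) (subT-lam σ t et (body ∷ q)))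
... | Δ , _ , _ , _ , db' , s , q with TypedSubst-exts⁻ s
... | _ , _ , s' , e₀ , e' =
  -, -, -, -, ⊢lam et db' (↭-trans p (↭-trans (types₀-↭ (↭-sym q)) (↭-reflexive e₀))) , s' ,
  ↭-trans (↭-reflexive (sym e')) (lower-↭ q)
typed-subT⁻-at σ t (⊢app _ df ds) e app et
  with typed-subT⁻ σ (child left t) df (λ q → trans (e (left ∷ q)) (subT-app σ t et (left ∷ q)))
     | typedAll-subT⁻ σ (child right t) ds (λ q → trans (e (right ∷ q)) (subT-app σ t et (right ∷ q)))
... | _ , _ , _ , _ , df' , s₁ , q₁ | _ , _ , _ , _ , ds' , s₂ , q₂ =
  -, -, -, -, ⊢app et df' ds' , TypedSubst-++ s₁ s₂ , ++⁺ q₁ q₂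
typed-subT⁻-at σ t (⊢var e₀) e lam et = contradiction (trans (sym e₀) (trans (e []) (subT-lam σ t et []))) λ ()
typed-subT⁻-at σ t (⊢app e₀ _ _) e lam et = contradiction (trans (sym e₀) (trans (e []) (subT-lam σ t et []))) λ ()
typed-subT⁻-at σ t (⊢var e₀) e app et = contradiction (trans (sym e₀) (trans (e []) (subT-app σ t et []))) λ ()
typed-subT⁻-at σ t (⊢lam e₀ _ _) e app et = contradiction (trans (sym e₀) (trans (e []) (subT-app σ t et []))) λ ()
typed-subT⁻-at σ t d e none et = contradiction (trans (e []) (subT-none σ t et [])) (typed-present d)
typedAll-subT⁻ σ t ⊢[] e = -, -, -, -, ⊢[] , ⊢σ[] , ↭-refl
typedAll-subT⁻ σ t (⊢∷ d ds) e with typed-subT⁻ σ t d e | typedAll-subT⁻ σ t ds e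
... | _ , _ , _ , _ , d' , s₁ , q₁ | _ , _ , _ , _ , ds' , s₂ , q₂ =
  -, -, -, -, ⊢∷ d' ds' , TypedSubst-++ s₁ s₂ , ++⁺ q₁ q₂

Typed↭ : Tree → Ty → Ctx → Set
Typed↭ t A Γ = ∃₂ λ Γ' n → Γ' ↭ Γ × Typed t A Γ' n

TypedAll↭ : Tree → List Ty → Ctx → Set
TypedAll↭ t As Γ = ∃₂ λ Γ' n → Γ' ↭ Γ × TypedAll t As Γ' n

typedAll-expansion : ∀ {a a'} → (∀ {A Γ n} → Typed a' A Γ n → Typed↭ a A Γ) →
                     ∀ {As Γ n} → TypedAll a' As Γ n → TypedAll↭ a As Γ
typedAll-expansion expand ⊢[] = -, -, ↭-refl , ⊢[]
typedAll-expansion expand (⊢∷ d ds) with expand d | typedAll-expansion expand ds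
... | _ , _ , q₁ , d' | _ , _ , q₂ , ds' = -, -, ++⁺ q₁ q₂ , ⊢∷ d' ds'

subject-expansion : ∀ {t t'} → t →β t' → ∀ {A Γ n} → Typed t' A Γ n → Typed↭ t A Γ
subject-expansion (β {b = b} {a = a} e e') d with typed-subT⁻ (single a) b d e'
... | Δ , _ , _ , _ , db , s , q with TypedSubst-single⁻ s
... | _ , _ , ds , q' =
  -, -, ↭-trans (↭-sym q') q , Typed-resp (≗-sym e) (⊢app refl (⊢lam refl db ↭-refl) ds)
subject-expansion (lamξ e e' r) d with typed-lam⁻ d (e' [])
... | lamTyping db p with subject-expansion r (Typed-resp (λ q → e' (body ∷ q)) db)
... | _ , _ , q , db' =
  -, -, lower-↭ q , ⊢lam (e []) (Typed-resp (λ q → sym (e (body ∷ q))) db') (↭-trans p (types₀-↭ (↭-sym q)))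
subject-expansion (appL e e' r) d with typed-app⁻ d (e' [])
... | appTyping {Δ = Δ} df ds with subject-expansion r (Typed-resp (λ q → e' (left ∷ q)) df)
... | _ , _ , q , df' =
  -, -, ++⁺ʳ Δ q ,
  ⊢app (e []) (Typed-resp (λ q → sym (e (left ∷ q))) df') (TypedAll-resp (λ q → trans (e' (right ∷ q)) (sym (e (right ∷ q)))) ds)
subject-expansion (appR e e' r) d with typed-app⁻ d (e' [])
... | appTyping {Γ = Γ} df ds with typedAll-expansion (subject-expansion r) (TypedAll-resp (λ q → e' (right ∷ q)) ds)
... | _ , _ , q , ds' =
  -, -, ++⁺ˡ Γ q ,
  ⊢app (e []) (Typed-resp (λ q → trans (e' (left ∷ q)) (sym (e (left ∷ q)))) df) (TypedAll-resp (λ q → sym (e (right ∷ q))) ds')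

subject-expansion* : ∀ {t t'} → t →β* t' → ∀ {A Γ n} → Typed t' A Γ n → Typed↭ t A Γ
subject-expansion* ε d = -, -, ↭-refl , d
subject-expansion* (r ◅ rs) d with subject-expansion* rs d
... | _ , _ , q , d' with subject-expansion r d'
... | _ , _ , q' , d'' = -, -, ↭-trans q' q , d''

-- Subject reduction decreases the size of derivations

Typed↭≤ : Tree → Ty → Ctx → ℕ → Set
Typed↭≤ t A Γ b = ∃₂ λ Γ' n → Γ' ↭ Γ × Typed t A Γ' n × n ≤ b

TypedAll↭≤ : Tree → List Ty → Ctx → ℕ → Set
TypedAll↭≤ t As Γ b = ∃₂ λ Γ' n → Γ' ↭ Γ × TypedAll t As Γ' n × n ≤ b

+-mono-≤-interchange : ∀ {m n} a b c d → m ≤ a + c → n ≤ b + d → m + n ≤ (a + b) + (c + d)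
+-mono-≤-interchange {m} {n} a b c d p q = subst (m + n ≤_) (interchange a c b d) (+-mono-≤ p q)

typed-subT : ∀ {σ t A Δ n Γ m} → Typed t A Δ n → TypedSubst σ Δ Γ m → Typed↭≤ (subT σ t) A Γ (n + m)
typedAll-subT : ∀ {σ t As Δ n Γ m} → TypedAll t As Δ n → TypedSubst σ Δ Γ m → TypedAll↭≤ (subT σ t) As Γ (n + m)
typed-subT {σ} {t} (⊢var e) (⊢σ∷ {Γ = Γ} {n = n} d ⊢σ[]) =
  -, -, ↭-reflexive (sym (++-identityʳ Γ)) , Typed-resp (≗-sym (subT-var σ t e)) d , m≤m+n n 0
typed-subT {σ} {t} (⊢lam {Γ = Δ} e db p) s with TypedSubst-exts Δ s
... | _ , s* , e₀ , e' with typed-subT db s*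
... | _ , _ , q , db' , le =
  -, -, ↭-trans (lower-↭ q) (↭-reflexive e') ,
  Typed-resp (≗-sym (subT-lam σ t e)) (⊢lam refl db' (↭-trans p (↭-trans (↭-reflexive (sym e₀)) (types₀-↭ (↭-sym q))))) ,
  s≤s le
typed-subT {σ} {t} (⊢app {Γ = Δ₁} {n = n₁} {m = n₂} e df ds) s with TypedSubst-split Δ₁ s
... | _ , _ , m₁ , m₂ , refl , refl , s₁ , s₂ with typed-subT df s₁ | typedAll-subT ds s₂
... | _ , _ , q₁ , df' , le₁ | _ , _ , q₂ , ds' , le₂ =
  -, -, ++⁺ q₁ q₂ , Typed-resp (≗-sym (subT-app σ t e)) (⊢app refl df' ds') ,
  s≤s (+-mono-≤-interchange n₁ n₂ m₁ m₂ le₁ le₂)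
typedAll-subT ⊢[] ⊢σ[] = -, -, ↭-refl , ⊢[] , z≤n
typedAll-subT (⊢∷ {Γ = Δ₁} {n = n₁} {m = n₂} d ds) s with TypedSubst-split Δ₁ s
... | _ , _ , m₁ , m₂ , refl , refl , s₁ , s₂ with typed-subT d s₁ | typedAll-subT ds s₂
... | _ , _ , q₁ , d' , le₁ | _ , _ , q₂ , ds' , le₂ =
  -, -, ++⁺ q₁ q₂ , ⊢∷ d' ds' , +-mono-≤-interchange n₁ n₂ m₁ m₂ le₁ le₂

typedAll-↭ : ∀ {a As As'} → As ↭ As' → ∀ {Γ n} → TypedAll a As Γ n → ∃ λ Γ' → Γ' ↭ Γ × TypedAll a As' Γ' n
typedAll-↭ ↭.refl ds = -, ↭-refl , ds
typedAll-↭ (prep _ p) (⊢∷ {Γ = Γ} d ds) with typedAll-↭ p ds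
... | _ , q , ds' = -, ++⁺ˡ Γ q , ⊢∷ d ds'
typedAll-↭ (swap _ _ p) (⊢∷ {Γ = Γ₁} {n = n₁} d₁ (⊢∷ {Γ = Γ₂} {n = n₂} {m = m} d₂ ds)) with typedAll-↭ p ds
... | Γ' , q , ds' =
  Γ₂ ++ Γ₁ ++ Γ' , ↭-trans (shifts Γ₂ Γ₁) (++⁺ˡ Γ₁ (++⁺ˡ Γ₂ q)) ,
  subst (TypedAll _ _ _) (x∙yz≈y∙xz n₂ n₁ m) (⊢∷ d₂ (⊢∷ d₁ ds'))
typedAll-↭ (↭.trans p p') ds with typedAll-↭ p ds
... | _ , q , ds₁ with typedAll-↭ p' ds₁
... | _ , q' , ds₂ = -, ↭-trans q' q , ds₂

typed-β-reduct : ∀ {b a As A Γ Δ n m} → Typed (lamT b) (As ⇛ A) Γ n → TypedAll a As Δ m →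
                 Typed↭≤ (b ⟪ a ⟫) A (Γ ++ Δ) (n + m)
typed-β-reduct {Δ = Δ} d ds with typed-lam⁻ d refl
... | lamTyping {Γ = Δ₀} db p with typedAll-↭ p ds
... | _ , q , ds' with TypedSubst-single Δ₀ ds'
... | _ , s , q' with typed-subT db s
... | _ , _ , q'' , d' , le =
  -, -, ↭-trans q'' (↭-trans q' (++⁺ˡ (lower Δ₀) q)) , d' , ≤-trans le (n≤1+n _)

data Progress (t : Tree) (A : Ty) (Γ : Ctx) (n : ℕ) : Set where
  done : HNF t → Progress t A Γ n
  step : ∀ {t' Γ' n'} → t →β t' → Γ' ↭ Γ → n' < n → Typed t' A Γ' n' → Progress t A Γ n

progress : ∀ {t A Γ n} → Typed t A Γ n → Λ∞ t → Progress t A Γ n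
progress (⊢var e) L = done (head (var _ (Λ∞-var-view L e)))
progress {t} (⊢lam e db p) L with progress db (Λ∞-body L (Λ∞-lam-view L e))
... | done h = done (lam (child body t) (Λ∞-lam-view L e) h)
... | step r q lt db' =
  step (lamξ (Λ∞-lam-view L e) (λ _ → refl) r) (lower-↭ q) (s≤s lt) (⊢lam refl db' (↭-trans p (types₀-↭ (↭-sym q))))
progress {t} (⊢app {Δ = Δ} {m = m} e df ds) L with progress df (Λ∞-fun L (Λ∞-app-view L e))
... | step r q lt df' =
  step (appL (Λ∞-app-view L e) (λ _ → refl) r) (++⁺ʳ Δ q) (s≤s (+-monoˡ-≤ m lt)) (⊢app refl df' ds)
... | done (head h) = done (head (app _ _ (Λ∞-app-view L e) h))
... | done (lam b e' _) with typed-β-reduct (Typed-resp e' df) ds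
... | _ , _ , q , d , le = step (β (≗-trans (Λ∞-app-view L e) (appT-cong e' (λ _ → refl))) (λ _ → refl)) q (s≤s le) d

HeadNormalises : Tree → Ty → Ctx → Set
HeadNormalises t A Γ = ∃ λ u → t →β* u × HNF u × Λ∞ u × Typed↭ u A Γ

typed⇒head-normalises : ∀ {t A Γ n} → Typed t A Γ n → Λ∞ t → HeadNormalises t A Γ
typed⇒head-normalises d = go (<-wellFounded _) d
  where
  go : ∀ {t A Γ n} → Acc _<_ n → Typed t A Γ n → Λ∞ t → HeadNormalises t A Γ
  go {t} _ d L with progress d L
  ... | done h = t , ε , h , L , -, -, ↭-refl , d
  go (acc rs) d L | step r q lt d' with go (rs lt) d' (Λ∞-→β L r)
  ... | u , rs' , h , Lu , _ , _ , q' , du = u , r ◅ rs' , h , Lu , -, -, ↭-trans q' q , du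

→β-resp : ∀ {t t' s} → t ≗ t' → t' →β s → t →β s
→β-resp e (β e₁ e₂) = β (≗-trans e e₁) e₂
→β-resp e (lamξ e₁ e₂ r) = lamξ (≗-trans e e₁) e₂ r
→β-resp e (appL e₁ e₂ r) = appL (≗-trans e e₁) e₂ r
→β-resp e (appR e₁ e₂ r) = appR (≗-trans e e₁) e₂ r

→β*-resp : ∀ {t t' u} → t ≗ t' → t' →β* u → ∃ λ u' → t →β* u' × u' ≗ u
→β*-resp {t} e ε = t , ε , e
→β*-resp {u = u} e (r ◅ rs) = u , →β-resp e r ◅ rs , λ _ → refl

→β*-lamT : ∀ {w b b'} → w ≗ lamT b → b →β* b' → ∃ λ u → w →β* u × u ≗ lamT b'
→β*-lamT {w} e ε = w , ε , e
→β*-lamT e (r ◅ rs) with →β*-lamT (λ _ → refl) rs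
... | u , rs' , e' = u , lamξ e (λ _ → refl) r ◅ rs' , e'

→β*-appT : ∀ {w f f' a} → w ≗ appT f a → f →β* f' → ∃ λ u → w →β* u × u ≗ appT f' a
→β*-appT {w} e ε = w , ε , e
→β*-appT e (r ◅ rs) with →β*-appT (λ _ → refl) rs
... | u , rs' , e' = u , appL e (λ _ → refl) r ◅ rs' , e'

child-subtree : ∀ t p d → child d (subtree t p) ≗ subtree t (p · d)
child-subtree t p d q = cong t (sym (++-assoc p [ d ] q))

subtree-root : ∀ t p → subtree t p [] ≡ t p
subtree-root t p = cong t (++-identityʳ p)

→β∞-refl : ∀ {t} → Λ∞ t → t →β∞ t
→β∞-refl {t} L = record { src = subtree t ; root = λ _ → refl ; rules = rule }
  where
  Lₚ : ∀ {p n} → t p ≡ n → ¬ n ≡ none → Λ∞ (subtree t p)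
  Lₚ {p} e n≢none = Λ∞-subtree p L (λ e' → n≢none (trans (sym e) e'))
  rule : ∀ p → RuleAt (subtree t) p (t p)
  rule p with t p in e
  ... | var x = subtree t p , ε , Λ∞-var-view (Lₚ e λ ()) (trans (subtree-root t p) e)
  ... | lam = subtree t p , ε ,
    ≗-trans (Λ∞-lam-view (Lₚ e λ ()) (trans (subtree-root t p) e)) (lamT-cong (child-subtree t p body))
  ... | app = subtree t p , ε ,
    ≗-trans (Λ∞-app-view (Lₚ e λ ()) (trans (subtree-root t p) e))
      (appT-cong (child-subtree t p left) (child-subtree t p right))
  ... | none = tt

→β∞-resp : ∀ {M M' N} → M ≗ M' → M →β∞ N → M' →β∞ N
→β∞-resp e R = record { src = src ; root = ≗-trans root e ; rules = rules }
  where open _→β∞_ R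

→β*-→β∞ : ∀ {M M' N} → M →β* M' → M' →β∞ N → M →β∞ N
→β*-→β∞ {M} {M'} {N} rs R = record { src = src' ; root = λ _ → refl ; rules = rule }
  where
  open _→β∞_ R
  src' : Pos → Tree
  src' [] = M
  src' (d ∷ p) = src (d ∷ p)
  prefix : ∀ {w} → src [] →β* w → ∃ λ w' → M →β* w' × w' ≗ w
  prefix rs₀ with →β*-resp (≗-sym root) rs₀
  ... | w' , rs₀' , e = w' , rs ◅◅ rs₀' , e
  rule : ∀ p → RuleAt src' p (N p)
  rule (d ∷ p) with N (d ∷ p) | rules (d ∷ p)
  ... | var x | r = r
  ... | lam | r = r
  ... | app | r = r
  ... | none | r = r
  rule [] with N [] | rules []
  ... | var x | _ , rs₀ , e with prefix rs₀
  ...   | w , rs' , e' = w , rs' , ≗-trans e' e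
  rule [] | lam | _ , rs₀ , e with prefix rs₀
  ...   | w , rs' , e' = w , rs' , ≗-trans e' e
  rule [] | app | _ , rs₀ , e with prefix rs₀
  ...   | w , rs' , e' = w , rs' , ≗-trans e' e
  rule [] | none | _ = tt

HeadApp-resp : ∀ {t t'} → t ≗ t' → HeadApp t → HeadApp t'
HeadApp-resp e (var y e') = var y (≗-trans (≗-sym e) e')
HeadApp-resp e (app f a e' h) = app f a (≗-trans (≗-sym e) e') h

HNF-resp : ∀ {t t'} → t ≗ t' → HNF t → HNF t'
HNF-resp e (head h) = head (HeadApp-resp e h)
HNF-resp e (lam b e' h) = lam b (≗-trans (≗-sym e) e') h

-- The head normal form of N is a finite part of N, so only finitely many
-- rules of the derivation of M →β^∞ N concern it.
module _ {M N : Tree} (R : M →β∞ N) where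
  open _→β∞_ R

  private
    node-at : ∀ p {s} → s ≗ subtree N p → N p ≡ s []
    node-at p e = trans (sym (subtree-root N p)) (sym (e []))

    child-at : ∀ p d {s} → s ≗ subtree N p → child d s ≗ subtree N (p · d)
    child-at p d e q = trans (e (d ∷ q)) (child-subtree N p d q)

    rule-var : ∀ {p x} → N p ≡ var x → ∃ λ u → src p →β* u × u ≗ varT x
    rule-var {p} e with rules p
    ... | r rewrite e = r

    rule-lam : ∀ {p} → N p ≡ lam → ∃ λ u → src p →β* u × u ≗ lamT (src (p · body))
    rule-lam {p} e with rules p
    ... | r rewrite e = r

    rule-app : ∀ {p} → N p ≡ app → ∃ λ u → src p →β* u × u ≗ appT (src (p · left)) (src (p · right))
    rule-app {p} e with rules p
    ... | r rewrite e = r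

    headApp-at : ∀ p {s} → HeadApp s → s ≗ subtree N p → ∃ λ u → src p →β* u × HeadApp u
    headApp-at p (var y e) e' with rule-var (trans (node-at p e') (e []))
    ... | w , rs , ew = w , rs , var y ew
    headApp-at p (app f a e h) e' with rule-app (trans (node-at p e') (e []))
                                 | headApp-at (p · left) h (≗-trans (λ q → sym (e (left ∷ q))) (child-at p left e'))
    ... | w , rs , ew | u , rs' , hu with →β*-appT ew rs'
    ... | v , rs'' , ev = v , rs ◅◅ rs'' , app u _ ev hu

    hnf-at : ∀ p {s} → HNF s → s ≗ subtree N p → ∃ λ u → src p →β* u × HNF u
    hnf-at p (head h) e' with headApp-at p h e'
    ... | u , rs , hu = u , rs , head hu
    hnf-at p (lam b e h) e' with rule-lam (trans (node-at p e') (e []))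
                            | hnf-at (p · body) h (≗-trans (λ q → sym (e (body ∷ q))) (child-at p body e'))
    ... | w , rs , ew | u , rs' , hu with →β*-lamT ew rs'
    ... | v , rs'' , ev = v , rs ◅◅ rs'' , lam u ev hu

  →β∞-hnf⇒→β*-hnf : HNF N → ∃ λ u → M →β* u × HNF u
  →β∞-hnf⇒→β*-hnf h with hnf-at [] h (λ _ → refl)
  ... | u , rs , hu with →β*-resp (≗-sym root) rs
  ... | u' , rs' , e = u' , rs' , HNF-resp (≗-sym e) hu

-- Typing head normal forms

ι : Ty
ι = [ o ] ⇛ o

nulls : ℕ → Ty → Ty
nulls zero B = B
nulls (suc k) B = [] ⇛ nulls k B

nulls-suc : ∀ k B → nulls k ([] ⇛ B) ≡ [] ⇛ nulls k B
nulls-suc zero B = refl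
nulls-suc (suc k) B = cong ([] ⇛_) (nulls-suc k B)

headApp-typed : ∀ {h} → HeadApp h → ∀ B → ∃₂ λ y k → ∃ λ n → Typed h B [ (y , nulls k B) ] n
headApp-typed (var y e) B = y , 0 , 0 , ⊢var (e [])
headApp-typed (app f a e h) B with headApp-typed h ([] ⇛ B)
... | y , k , n , d = y , suc k , _ ,
  Typed-resp (≗-sym e) (⊢app refl (subst (λ C → Typed f ([] ⇛ B) [ (y , C) ] n) (nulls-suc k B) d) ⊢[])

data Closing (n : ℕ) : Ty → Set where
  ι-closing : Closing n ι
  skip      : ∀ {A} → Closing n A → Closing n ([] ⇛ A)
  feed      : ∀ {A} → Closing n A → Closing n ([ nulls n ι ] ⇛ A)

nulls-closing : ∀ {n} j → Closing n (nulls j ι)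
nulls-closing zero = ι-closing
nulls-closing (suc j) = skip (nulls-closing j)

-- The typings given to head normal forms: closed, or declaring only the free
-- head variable z.
data Closable (t : Tree) : Set where
  closed : ∀ {n A m} → Closing n A → Typed t A [] m → Closable t
  free   : ∀ {n j z m} → Typed t (nulls j ι) [ (z , nulls n ι) ] m → Closable t

hnf-closable : ∀ {u} → HNF u → Closable u
hnf-closable (head h) with headApp-typed h ι
... | _ , _ , _ , d = free {j = 0} d
hnf-closable (lam b e h) with hnf-closable h
... | closed c d = closed (skip c) (⊢lam (e []) (Typed-resp (λ q → sym (e (body ∷ q))) d) ↭-refl)
... | free {j = j} {z = zero} d =
  closed (feed (nulls-closing j)) (⊢lam (e []) (Typed-resp (λ q → sym (e (body ∷ q))) d) ↭-refl)
... | free {j = j} {z = suc z} d = free {j = suc j} (⊢lam (e []) (Typed-resp (λ q → sym (e (body ∷ q))) d) ↭-refl)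

closable-expansion : ∀ {t t'} → t →β* t' → Closable t' → Closable t
closable-expansion rs (closed c d) with subject-expansion* rs d
... | _ , _ , q , d' with ↭-empty-inv q
... | refl = closed c d'
closable-expansion rs (free d) with subject-expansion* rs d
... | _ , _ , q , d' with ↭-singleton-inv q
... | refl = free d'

K : ℕ → FinTerm
K zero = lam (var zero)
K (suc n) = lam (K n)

K-typed : ∀ n → ∃ λ m → Typed ⌜ K n ⌝ (nulls n ι) [] m
K-typed zero = -, ⊢lam refl (⊢var refl) ↭-refl
K-typed (suc n) = -, ⊢lam refl (proj₂ (K-typed n)) ↭-refl

closing-args : ∀ {n A} → Closing n A → List FinTerm
closing-args ι-closing = []
closing-args {n} (skip c) = K n ∷ closing-args c
closing-args {n} (feed c) = K n ∷ closing-args c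

closing-args-typed : ∀ {n A t m} (c : Closing n A) → Typed t A [] m →
                     ∃ λ m' → Typed (apps t ⌜ closing-args c ⌝s) ι [] m'
closing-args-typed ι-closing d = -, d
closing-args-typed (skip c) d = closing-args-typed c (⊢app refl d ⊢[])
closing-args-typed {n} (feed c) d = closing-args-typed c (⊢app refl d (⊢∷ (proj₂ (K-typed n)) ⊢[]))

abs-ren-self : ∀ z → abs-ren z z ≡ zero
abs-ren-self z with z ≟ z
... | yes _ = refl
... | no z≢z = contradiction refl z≢z

closable⇒ι-typed-closure : ∀ {M} → Closable M → ∃₂ λ xs Ns → ∃ λ m → Typed (apps (ƛs xs M) ⌜ Ns ⌝s) ι [] m
closable⇒ι-typed-closure (closed c d) = [] , closing-args c , closing-args-typed c d
closable⇒ι-typed-closure {M} (free {n} {j} {z} {m} d) =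
  [ z ] , closing-args (feed {n} (nulls-closing j)) , closing-args-typed (feed (nulls-closing j)) (⊢lam refl d₀ ↭-refl)
  where
  d₀ : Typed (renT (abs-ren z) M) (nulls j ι) [ (zero , nulls n ι) ] m
  d₀ = subst (λ y → Typed (renT (abs-ren z) M) (nulls j ι) [ (y , nulls n ι) ] m) (abs-ren-self z) (typed-renT (abs-ren z) d)

head-declaration : ∀ {h A Γ n} → HeadApp h → Typed h A Γ n →
  (∃ λ y → Γ ≡ [ (y , A) ] × h ≗ varT y) ⊎ (∃₂ λ y As → ∃₂ λ B Γ₀ → Γ ≡ (y , As ⇛ B) ∷ Γ₀)
head-declaration (var y e) d with typed-var⁻ d (e [])
... | refl = inj₁ (y , refl , e)
head-declaration (app f a e h) d with typed-app⁻ d (e [])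
... | appTyping {Δ = Δ} df _ with head-declaration h (Typed-resp (λ q → e (left ∷ q)) df)
... | inj₁ (y , refl , _) = inj₂ (y , _ , _ , Δ , refl)
... | inj₂ (y , _ , _ , Γ₀ , refl) = inj₂ (y , _ , _ , Γ₀ ++ Δ , refl)

-- In a closed typing of λx.b by ι = [o] ⇛ o, the variable x is the only free
-- variable of b and it has type o; so b cannot be a head application.
closed-ι-hnf⇒𝐈 : ∀ {h Γ n} → HNF h → Typed h ι Γ n → Γ ≡ [] → h ≗ 𝐈
closed-ι-hnf⇒𝐈 (head h) d eΓ with head-declaration h d
... | inj₁ (_ , refl , _) with () ← eΓ
... | inj₂ (_ , _ , _ , _ , refl) with () ← eΓ
closed-ι-hnf⇒𝐈 (lam b e hb) d eΓ with typed-lam⁻ d (e [])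
... | lamTyping db p with hb
... | lam _ e' _ with () ← typed-lam⁻ (Typed-resp (λ q → e (body ∷ q)) db) (e' [])
... | head h with head-declaration h (Typed-resp (λ q → e (body ∷ q)) db)
... | inj₁ (zero , refl , e') = ≗-trans e (lamT-cong e')
... | inj₁ (suc _ , refl , _) with () ← eΓ
... | inj₂ (suc _ , _ , _ , _ , refl) with () ← eΓ
... | inj₂ (zero , _ , _ , _ , refl) with () ← ↭-singleton-inv (↭-sym p)

closed-ι-typed⇒→β*𝐈 : ∀ {t n} → Λ∞ t → Typed t ι [] n → ∃ λ u → t →β* u × u ≗ 𝐈
closed-ι-typed⇒→β*𝐈 L d with typed⇒head-normalises d L
... | u , rs , h , _ , _ , _ , q , du = u , rs , closed-ι-hnf⇒𝐈 h du (↭-empty-inv q)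

Typable : Tree → Set
Typable t = ∃₂ λ A Γ → ∃ λ n → Typed t A Γ n

apps-typable⁻ : ∀ {P} Ns → Typable (apps P Ns) → Typable P
apps-typable⁻ [] d = d
apps-typable⁻ (N ∷ Ns) d with apps-typable⁻ Ns d
... | _ , _ , _ , ⊢app _ df _ = -, -, -, df

ƛs-typable⁻ : ∀ xs {M} → Typable (ƛs xs M) → Typable M
ƛs-typable⁻ [] d = d
ƛs-typable⁻ (x ∷ xs) {M} (_ , _ , _ , ⊢lam _ db _) with typed-renT⁻ (abs-ren x) (ƛs xs M) db
... | _ , _ , d = ƛs-typable⁻ xs (-, -, -, d)

typable-expansion* : ∀ {t t'} → t →β* t' → Typable t' → Typable t
typable-expansion* rs (_ , _ , _ , d) with subject-expansion* rs d
... | _ , _ , _ , d' = -, -, -, d'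

closable⇒typable : ∀ {t} → Closable t → Typable t
closable⇒typable (closed _ d) = -, -, -, d
closable⇒typable (free d) = -, -, -, d

typable⇒head-normalisable : ∀ {M} → Λ∞ M → Typable M → HeadNormalisable M
typable⇒head-normalisable L (_ , _ , _ , d) with typed⇒head-normalises d L
... | u , rs , h , Lu , _ = u , Lu , →β*-→β∞ rs (→β∞-refl Lu) , h

𝐈-hnf : HNF 𝐈
𝐈-hnf = lam (varT zero) (λ _ → refl) (head (var zero (λ _ → refl)))

solvable∞⇒head-normalisable : ∀ {M} → Λ∞ M → SolvableInΛ∞ M → HeadNormalisable M
solvable∞⇒head-normalisable L (xs , Ns , _ , R) with →β∞-hnf⇒→β*-hnf R 𝐈-hnf
... | _ , rs , h =
  typable⇒head-normalisable L (ƛs-typable⁻ xs (apps-typable⁻ Ns (typable-expansion* rs (closable⇒typable (hnf-closable h)))))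

head-normalisable⇒solvable : ∀ {M} → Λ∞ M → HeadNormalisable M → SolvableInΛ M
head-normalisable⇒solvable L (_ , _ , R , h) with →β∞-hnf⇒→β*-hnf R h
... | _ , rs , hu with closable⇒ι-typed-closure (closable-expansion rs (hnf-closable hu))
... | xs , Ns , _ , d with closed-ι-typed⇒→β*𝐈 (Λ∞-apps ⌜ Ns ⌝s (Λ∞-ƛs xs L) Λ∞-⌜ Ns ⌝s) d
... | u , rs' , e = xs , Ns , u , rs' , e

solvable⇒solvable∞ : ∀ {M} → SolvableInΛ M → SolvableInΛ∞ M
solvable⇒solvable∞ (xs , Ns , _ , rs , e) =
  xs , ⌜ Ns ⌝s , Λ∞-⌜ Ns ⌝s , →β*-→β∞ rs (→β∞-resp (≗-sym e) (→β∞-refl (Λ∞-lamT (Λ∞-varT zero))))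

corollary5p8 : (M : Tree) → Λ∞ M →
    (SolvableInΛ∞ M ⇔ HeadNormalisable M) × (HeadNormalisable M ⇔ SolvableInΛ M)
corollary5p8 M L =
  mk⇔ (solvable∞⇒head-normalisable L) (solvable⇒solvable∞ ∘ head-normalisable⇒solvable L) ,
  mk⇔ (head-normalisable⇒solvable L) (solvable∞⇒head-normalisable L ∘ solvable⇒solvable∞)
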